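{- Let $\mathbf{P}$ be a noun system, let $\Gamma$ be a set of sentences of $\mathcal{L}(\mathbf{P})$ and let $\varphi$ be a sentence of $\mathcal{L}(\mathbf{P})$. If $\Gamma\vdash\varphi$, then $\Gamma\models\varphi$, i.e. every model (with infinite universe) in which all sentences of $\Gamma$ are true also makes $\varphi$ true.
   Context: Syntax. A noun system $\mathbf{P}=(P,\overline{\phantom{p}})$ is a set $P$ of nouns with an operation $p\mapsto\overline{p}$ on $P$ satisfying $\overline{\overline{p}}=p$. The sentences of $\mathcal{L}(\mathbf{P})$ are $\forall(p,q)$, $\exists(p,q)$, $\exists^{\geq}(p,q)$, $\exists^{>}(p,q)$ for $p,q\in P$. There are no connectives. Semantics. A model $\mathcal{M}$ is a set $M$ with a map $[\![\ ]\!]:P\to\mathcal{P}(M)$ (the power set of $M$) such that $[\![\overline{p}]\!]=M\setminus[\![p]\!]$ for all $p$. All models are assumed to have infinite universe $M$ (the sets $[\![p]\!]$ may be finite or empty). Truth: $\mathcal{M}\models\forall(p,q)$ iff $[\![p]\!]\subseteq[\![q]\!]$; $\mathcal{M}\models\exists(p,q)$ iff $[\![p]\!]\cap[\![q]\!]\neq\emptyset$; $\mathcal{M}\models\exists^{\geq}(p,q)$ iff $|[\![p]\!]|\geq|[\![q]\!]|$; $\mathcal{M}\models\exists^{>}(p,q)$ iff $|[\![p]\!]|>|[\![q]\!]|$. Proof system. $\Gamma\vdash\varphi$ means that there is a finite tree with root labelled $\varphi$, each node of which is either a leaf labelled by an element of $\Gamma$ or is obtained from its children by one of the following rules (premises $\Rightarrow$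 conclusion; $n,p,q,x$ arbitrary nouns, $\varphi$ an arbitrary sentence): (axiom) $\Rightarrow\forall(p,p)$; (barbara) $\forall(n,p),\forall(p,q)\Rightarrow\forall(n,q)$; (some) $\exists(p,q)\Rightarrow\exists(p,p)$; (conversion) $\exists(q,p)\Rightarrow\exists(p,q)$; (darii) $\exists(p,n),\forall(n,q)\Rightarrow\exists(p,q)$; (anti) $\forall(p,q)\Rightarrow\forall(\overline{q},\overline{p})$; (zero) $\forall(p,\overline{p})\Rightarrow\forall(p,q)$; (one) $\forall(\overline{p},p)\Rightarrow\forall(q,p)$; (subset-size) $\forall(p,q)\Rightarrow\exists^{\geq}(q,p)$; (card-trans) $\exists^{\geq}(n,p),\exists^{\geq}(p,q)\Rightarrow\exists^{\geq}(n,q)$; (card-$\exists$) $\exists(p,p),\exists^{\geq}(q,p)\Rightarrow\exists(q,q)$; (more-at least) $\exists^{>}(p,q)\Rightarrow\exists^{\geq}(p,q)$; (more-left) $\exists^{>}(n,p),\exists^{\geq}(p,q)\Rightarrow\exists^{>}(n,q)$; (more-right) $\exists^{\geq}(n,p),\exists^{>}(p,q)\Rightarrow\exists^{>}(n,q)$; (more-some) $\exists^{>}(p,q)\Rightarrow\exists(p,\overline{q})$; (x) $\exists(p,q),\forall(q,\overline{q})\Rightarrow\varphi$; (x-card) $\exists^{>}(p,q),\exists^{\geq}(q,p)\Rightarrow\varphi$; (non-empty) $\exists^{\geq}(p,\overline{p})\Rightarrow\exists(p,p)$; (non-empty-more) $\forall(\overline{p},p)\Rightarrow\exists^{>}(p,\overline{p})$;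 (weak-more-anti) $\exists^{>}(q,p)\Rightarrow\exists^{\geq}(\overline{p},x)$; (up) $\exists^{\geq}(x,p),\exists^{\geq}(x,\overline{p})\Rightarrow\exists^{\geq}(x,q)$. -}

module Defs where

open import Data.Fin.Base using (Fin)
open import Data.Nat.Base using (ℕ)
open import Data.Product.Base using (Σ; _×_; proj₁)
open import Function.Bundles using (Injection; _↔_)
open import Level using (Level; _⊔_; suc)
open import Relation.Binary.Bundles using (Setoid)
import Relation.Binary.Construct.On as On
open import Relation.Binary.PropositionalEquality using (_≡_; setoid)
open import Relation.Nullary.Negation.Core using (¬_)
open import Relation.Unary using (Pred; _∈_; _⊆_; _≐_; _∩_; ∁; Satisfiable)

private
  variable
    a g k m ℓ : Level

record NounSystem (k : Level) : Set (suc k) where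
  infix 9 _‾
  field
    Noun         : Set k
    _‾           : Noun → Noun
    ‾-involutive : ∀ p → (p ‾) ‾ ≡ p

-- `atLeast p q` is ∃^≥(p,q) and `more p q` is ∃^>(p,q).

data Sentence (P : NounSystem k) : Set k where
  all some atLeast more : (p q : NounSystem.Noun P) → Sentence P

Infinite : Set a → Set a
Infinite M = ∀ (n : ℕ) → ¬ (Fin n ↔ M)

-- A subset is a predicate, and its elements are compared by their first
-- components: the proofs of membership must not count towards its size.

SubsetSetoid : {M : Set m} → Pred M ℓ → Setoid (m ⊔ ℓ) m
SubsetSetoid {M = M} A = On.setoid {B = Σ M A} (setoid M) proj₁

infix 4 _≽_ _≻_

_≽_ : {M : Set m} → Pred M ℓ → Pred M ℓ → Set (m ⊔ ℓ)
A ≽ B = Injection (SubsetSetoid B) (SubsetSetoid A)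

-- The strict order of cardinals is the strict part of the order given by
-- injections.

_≻_ : {M : Set m} → Pred M ℓ → Pred M ℓ → Set (m ⊔ ℓ)
A ≻ B = A ≽ B × ¬ (B ≽ A)

record Model (P : NounSystem k) (m ℓ : Level) : Set (k ⊔ suc (m ⊔ ℓ)) where
  open NounSystem P
  field
    Universe   : Set m
    infinite   : Infinite Universe
    ⟦_⟧        : Noun → Pred Universe ℓ
    complement : ∀ p → ⟦ p ‾ ⟧ ≐ ∁ ⟦ p ⟧

infix 4 _⊨_

_⊨_ : {P : NounSystem k} → Model P m ℓ → Sentence P → Set (m ⊔ ℓ)
𝓜 ⊨ all p q     = let open Model 𝓜 in ⟦ p ⟧ ⊆ ⟦ q ⟧
𝓜 ⊨ some p q    = let open Model 𝓜 in Satisfiable (⟦ p ⟧ ∩ ⟦ q ⟧)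
𝓜 ⊨ atLeast p q = let open Model 𝓜 in ⟦ p ⟧ ≽ ⟦ q ⟧
𝓜 ⊨ more p q    = let open Model 𝓜 in ⟦ p ⟧ ≻ ⟦ q ⟧

-- Γ ⊨[ m , ℓ ] φ is semantic consequence over models whose universe lies in
-- Set m and whose nouns denote ℓ-valued predicates.

infix 4 _⊨[_,_]_

_⊨[_,_]_ : {P : NounSystem k} → Pred (Sentence P) g → (m ℓ : Level) →
           Sentence P → Set (k ⊔ g ⊔ suc (m ⊔ ℓ))
_⊨[_,_]_ {P = P} Γ m ℓ φ =
  (𝓜 : Model P m ℓ) → (∀ ψ → ψ ∈ Γ → 𝓜 ⊨ ψ) → 𝓜 ⊨ φ

module _ {P : NounSystem k} where
  open NounSystem P

  infix 4 _⊢_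

  data _⊢_ (Γ : Pred (Sentence P) g) : Sentence P → Set (k ⊔ g) where
    leaf : ∀ {φ} → φ ∈ Γ → Γ ⊢ φ

    axiom      : ∀ {p} → Γ ⊢ all p p
    barbara    : ∀ {n p q} → Γ ⊢ all n p → Γ ⊢ all p q → Γ ⊢ all n q
    some-rule  : ∀ {p q} → Γ ⊢ some p q → Γ ⊢ some p p
    conversion : ∀ {p q} → Γ ⊢ some q p → Γ ⊢ some p q
    darii      : ∀ {n p q} → Γ ⊢ some p n → Γ ⊢ all n q → Γ ⊢ some p q
    anti       : ∀ {p q} → Γ ⊢ all p q → Γ ⊢ all (q ‾) (p ‾)
    zero-rule  : ∀ {p q} → Γ ⊢ all p (p ‾) → Γ ⊢ all p q
    one-rule   : ∀ {p q} → Γ ⊢ all (p ‾) p → Γ ⊢ all q p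

    subset-size   : ∀ {p q} → Γ ⊢ all p q → Γ ⊢ atLeast q p
    card-trans    : ∀ {n p q} → Γ ⊢ atLeast n p → Γ ⊢ atLeast p q →
                    Γ ⊢ atLeast n q
    card-∃        : ∀ {p q} → Γ ⊢ some p p → Γ ⊢ atLeast q p → Γ ⊢ some q q
    more-at-least : ∀ {p q} → Γ ⊢ more p q → Γ ⊢ atLeast p q
    more-left     : ∀ {n p q} → Γ ⊢ more n p → Γ ⊢ atLeast p q → Γ ⊢ more n q
    more-right    : ∀ {n p q} → Γ ⊢ atLeast n p → Γ ⊢ more p q → Γ ⊢ more n q
    more-some     : ∀ {p q} → Γ ⊢ more p q → Γ ⊢ some p (q ‾)

    x-rule : ∀ {p q φ} → Γ ⊢ some p q → Γ ⊢ all q (q ‾) → Γ ⊢ φ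
    x-card : ∀ {p q φ} → Γ ⊢ more p q → Γ ⊢ atLeast q p → Γ ⊢ φ

    non-empty      : ∀ {p} → Γ ⊢ atLeast p (p ‾) → Γ ⊢ some p p
    non-empty-more : ∀ {p} → Γ ⊢ all (p ‾) p → Γ ⊢ more p (p ‾)
    weak-more-anti : ∀ {p q x} → Γ ⊢ more q p → Γ ⊢ atLeast (p ‾) x
    up             : ∀ {p q x} → Γ ⊢ atLeast x p → Γ ⊢ atLeast x (p ‾) →
                     Γ ⊢ atLeast x q

-- The soundness of `weak-more-anti` and `up` is a fact of classical cardinal
-- arithmetic with choice.  `ExcludedMiddle` decides every type, not only the
-- proof-irrelevant ones, so it selects an element from every nonempty type;
-- extensionality makes that selection depend only on the extension of a
-- (Bool-valued) subset.  Together they give Zermelo's axiom of choice.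

open import Axiom.ExcludedMiddle public using (ExcludedMiddle)
open import Axiom.Extensionality.Propositional public using (Extensionality)

{-# OPTIONS --safe #-}
module Submission where

-- The rules about sizes rest on two facts of cardinal arithmetic: any two sets
-- are comparable under injections, and 2κ = κ for infinite κ.  If a set q is at
-- least as large as both p and its complement, then the infinite universe embeds
-- in q ⊎ q, hence in q; this is (up).  For (weak-more-anti), where |q| > |p|, the
-- complement of p cannot embed in p, since otherwise p would be as large as the
-- universe; so p embeds in its complement, which is then as large as the universe.
-- Both facts follow from the existence of maximal cliques of a binary relation: a
-- maximal partial injection, and a maximal family of disjoint injective sequences.

open import Defs
open import Data.Bool.Base using (Bool; true; false; T)
open import Data.Bool.Properties using (T-irrelevant)
open import Data.Empty using (⊥-elim)
open import Data.Fin.Base using (Fin)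
open import Data.Fin.Properties using (+↔⊎; ℕ→Fin-notInjective)
open import Data.Nat.Base using (ℕ; zero; suc; _+_; _*_; ≤′-refl; ≤′-step; _<′_)
open import Data.Nat.Properties using (*-cancelˡ-≡; suc-injective; even≢odd; <-cmp; ≤⇒≤′)
open import Data.Product.Base using (Σ; ∃; _×_; _,_; proj₁; proj₂)
open import Data.Product.Properties using (,-injective)
open import Data.Sum.Base using (_⊎_; inj₁; inj₂; [_,_]′)
open import Data.Sum.Function.Propositional using (_⊎-↣_; _⊎-↔_)
open import Data.Vec.Base using (Vec; []; _∷_; lookup)
open import Data.Vec.Membership.Propositional using () renaming (_∈_ to _∈ᵥ_)
open import Data.Vec.Relation.Unary.All as All using (All)
open import Data.Vec.Relation.Unary.All.Properties using (lookup⁻)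
open import Data.Vec.Relation.Unary.AllPairs using ([]; _∷_)
open import Data.Vec.Relation.Unary.Any using (here; there)
open import Data.Vec.Relation.Unary.Unique.Propositional using (Unique)
open import Data.Vec.Relation.Unary.Unique.Propositional.Properties using (lookup-injective)
open import Function.Base using (_∘_; id)
open import Function.Bundles using (Injection; _↣_; _↔_; mk↣; mk⤖)
open import Function.Construct.Composition using (_↣-∘_)
import Function.Construct.Composition as Composition
open import Function.Construct.Identity using (↣-id)
open import Function.Construct.Symmetry using (↔-sym)
open import Function.Definitions using (Injective)
open import Function.Properties.Bijection using (⤖⇒↔)
open import Function.Properties.Inverse using (↔⇒↣)
open import Level using (Level)
open import Relation.Binary.Definitions using (tri<; tri≈; tri>)
open import Relation.Binary.PropositionalEquality
  using (_≡_; _≢_; refl; sym; trans; cong)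
open import Relation.Nullary.Decidable.Core
  using (Dec; yes; no; isYes; toWitness; fromWitness; decidable-stable; toSum)
open import Relation.Nullary.Negation.Core using (¬_; contradiction)
open import Relation.Unary using (Pred; _∈_; _∉_; _⊆_; _⊆′_; _∪_; ∁; ｛_｝)

private
  variable
    a b ℓ x : Level
    A : Set a
    B : Set b

  open Injection using (to; injective)

section-↣ : (g : B → A) → (∀ x → ∃ λ y → g y ≡ x) → A ↣ B
section-↣ g h = mk↣ λ {x} {x′} eq →
  trans (sym (proj₂ (h x))) (trans (cong g eq) (proj₂ (h x′)))

interleave : (A × ℕ ⊎ A × ℕ) ↣ (A × ℕ)
interleave {A = A} = mk↣ {to = f} inj
  where
  f : A × ℕ ⊎ A × ℕ → A × ℕ
  f (inj₁ (x , i)) = x , 2 * i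
  f (inj₂ (x , i)) = x , suc (2 * i)

  inj : Injective _≡_ _≡_ f
  inj {inj₁ (x , i)} {inj₁ (y , j)} eq with refl , e ← ,-injective eq =
    cong (λ k → inj₁ (x , k)) (*-cancelˡ-≡ i j 2 e)
  inj {inj₁ (x , i)} {inj₂ (y , j)} eq = contradiction (cong proj₂ eq) (even≢odd i j)
  inj {inj₂ (x , i)} {inj₁ (y , j)} eq = contradiction (sym (cong proj₂ eq)) (even≢odd j i)
  inj {inj₂ (x , i)} {inj₂ (y , j)} eq with refl , e ← ,-injective eq =
    cong (λ k → inj₂ (x , k)) (*-cancelˡ-≡ i j 2 (suc-injective e))

module Classical
  (em : ∀ a → ExcludedMiddle a) (ext : ∀ a b → Extensionality a b) where

  stable : {A : Set a} → ¬ ¬ A → A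
  stable = decidable-stable (em _)

  Subset : Set a → Set a
  Subset X = X → Bool

  Mem : {X : Set x} → Subset X → Pred X _
  Mem S = T ∘ S

  -- Excluded middle makes every predicate Bool-valued, whatever its level;
  -- this resizing replaces impredicative power sets.
  ⟪_⟫ : {X : Set x} → Pred X ℓ → Subset X
  ⟪ P ⟫ x = isYes (em _ {P x})

  ⟪⟫⁺ : {X : Set x} (P : Pred X ℓ) → P ⊆ Mem ⟪ P ⟫
  ⟪⟫⁺ P {x} = fromWitness {a? = em _ {P x}}

  ⟪⟫⁻ : {X : Set x} (P : Pred X ℓ) → Mem ⟪ P ⟫ ⊆ P
  ⟪⟫⁻ P {x} = toWitness {a? = em _ {P x}}

  -- Maximal cliques of a binary relation, by Zermelo's tower argument.

  module MaximalClique {X : Set x} (_~_ : X → X → Set x) where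

    infix 4 _⊑_
    _⊑_ : Subset X → Subset X → Set x
    S ⊑ R = Mem S ⊆′ Mem R

    ⊑-refl : ∀ {S} → S ⊑ S
    ⊑-refl _ = id

    ⊑-trans : ∀ {S R Q} → S ⊑ R → R ⊑ Q → S ⊑ Q
    ⊑-trans f g y = g y ∘ f y

    ⊑-antisym : ∀ {S R} → S ⊑ R → R ⊑ S → S ≡ R
    ⊑-antisym S⊑R R⊑S = ext _ _ λ y → T-injective (S⊑R y) (R⊑S y)
      where
      T-injective : ∀ {b c} → (T b → T c) → (T c → T b) → b ≡ c
      T-injective {false} {false} _ _ = refl
      T-injective {false} {true}  _ g = ⊥-elim (g _)
      T-injective {true}  {false} f _ = ⊥-elim (f _)
      T-injective {true}  {true}  _ _ = refl

    -- The two members may coincide, so each member is related to itself; hence the condition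
    -- `z ~ z` in `Compatible`.
    Clique : Subset X → Set x
    Clique S = ∀ {y z} → y ∈ Mem S → z ∈ Mem S → y ~ z

    Compatible : Subset X → Pred X x
    Compatible S z = z ~ z × (∀ {y} → y ∈ Mem S → z ~ y × y ~ z)

    Addable : Subset X → Pred X x
    Addable S z = z ∉ Mem S × Compatible S z

    insert : X → Subset X → Subset X
    insert z S = ⟪ Mem S ∪ ｛ z ｝ ⟫

    -- The decision is an argument so that it can be analysed by pattern matching.
    add : (S : Subset X) → Dec (∃ (Addable S)) → Subset X
    add S (yes (z , _)) = insert z S
    add S (no _)        = S

    next : Subset X → Subset X
    next S = add S (em _)

    InSome : Subset (Subset X) → Pred X x
    InSome 𝒮 y = ∃ λ S → S ∈ Mem 𝒮 × y ∈ Mem S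

    ⋃ : Subset (Subset X) → Subset X
    ⋃ 𝒮 = ⟪ InSome 𝒮 ⟫

    ⋃-upper : ∀ 𝒮 {S} → S ∈ Mem 𝒮 → S ⊑ ⋃ 𝒮
    ⋃-upper 𝒮 S∈𝒮 _ y∈S = ⟪⟫⁺ (InSome 𝒮) (_ , S∈𝒮 , y∈S)

    ⋃-least : ∀ 𝒮 {R} → (∀ {S} → S ∈ Mem 𝒮 → S ⊑ R) → ⋃ 𝒮 ⊑ R
    ⋃-least 𝒮 h y y∈ with _ , S∈𝒮 , y∈S ← ⟪⟫⁻ (InSome 𝒮) y∈ = h S∈𝒮 y y∈S

    S⊑add : ∀ S d → S ⊑ add S d
    S⊑add S (yes (z , _)) _ y∈S = ⟪⟫⁺ (Mem S ∪ ｛ z ｝) (inj₁ y∈S)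
    S⊑add S (no _)        _ y∈S = y∈S

    S⊑next : ∀ S → S ⊑ next S
    S⊑next S = S⊑add S (em _)

    -- The tower of Zermelo's proof; it is linearly ordered by inclusion, so its
    -- unions are again cliques.
    data Stage : Pred (Subset X) x where
      step  : ∀ {S} → Stage S → Stage (next S)
      union : ∀ 𝒮 → (∀ {S} → S ∈ Mem 𝒮 → Stage S) → Stage (⋃ 𝒮)

    -- Excluded middle moves the disjunction out of the quantifier over `𝒮`: either `P` holds once,
    -- or every member is below `R`.
    ⋃-split : ∀ 𝒮 {R} {P : Set x} →
              (∀ {S} → S ∈ Mem 𝒮 → P ⊎ S ⊑ R) → P ⊎ ⋃ 𝒮 ⊑ R
    ⋃-split 𝒮 {P = P} h with em _ {P}
    ... | yes p = inj₁ p
    ... | no ¬p = inj₂ (⋃-least 𝒮 λ S∈𝒮 → [ (λ p → contradiction p ¬p) , id ]′ (h S∈𝒮))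

    -- The hypothesis makes `R` an extreme point in the sense of Bourbaki and Witt; induction on the
    -- stage `S` then shows that the tower cannot pass `R` without meeting it.
    stage-compare : ∀ {S R} → Stage S →
                    (∀ {Q} → Stage Q → Q ⊑ R → R ≡ Q ⊎ next Q ⊑ R) →
                    next R ⊑ S ⊎ S ⊑ R
    stage-compare (step {S} s) h with stage-compare s h
    ... | inj₁ R⁺⊑S = inj₁ (⊑-trans R⁺⊑S (S⊑next S))
    ... | inj₂ S⊑R with h s S⊑R
    ...   | inj₁ refl = inj₁ ⊑-refl
    ...   | inj₂ S⁺⊑R = inj₂ S⁺⊑R
    stage-compare {R = R} (union 𝒮 f) h = ⋃-split 𝒮 λ S∈𝒮 →
      [ (λ R⁺⊑S → inj₁ (⊑-trans R⁺⊑S (⋃-upper 𝒮 S∈𝒮))) , inj₂ ]′ (stage-compare (f S∈𝒮) h)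

    -- Every stage is extreme. In the induction on `R`, the induction hypothesis is exactly what
    -- `stage-compare` requires of the earlier stages.
    stage-gap : ∀ {Q R} → Stage R → Stage Q → Q ⊑ R → R ≡ Q ⊎ next Q ⊑ R
    stage-gap {Q} (step {R} r) q Q⊑R⁺ with stage-compare q (stage-gap r)
    ... | inj₁ R⁺⊑Q = inj₁ (⊑-antisym R⁺⊑Q Q⊑R⁺)
    ... | inj₂ Q⊑R with stage-gap r q Q⊑R
    ...   | inj₁ refl = inj₂ ⊑-refl
    ...   | inj₂ Q⁺⊑R = inj₂ (⊑-trans Q⁺⊑R (S⊑next R))
    stage-gap {Q} (union 𝒮 f) q Q⊑⋃ =
      [ inj₂ , (λ ⋃⊑Q → inj₁ (⊑-antisym ⋃⊑Q Q⊑⋃)) ]′ (⋃-split 𝒮 bound)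
      where
      bound : ∀ {S} → S ∈ Mem 𝒮 → next Q ⊑ ⋃ 𝒮 ⊎ S ⊑ Q
      bound {S} S∈𝒮 with stage-compare q (stage-gap (f S∈𝒮))
      ... | inj₁ S⁺⊑Q = inj₂ (⊑-trans (S⊑next S) S⁺⊑Q)
      ... | inj₂ Q⊑S with stage-gap (f S∈𝒮) q Q⊑S
      ...   | inj₁ refl = inj₂ ⊑-refl
      ...   | inj₂ Q⁺⊑S = inj₁ (⊑-trans Q⁺⊑S (⋃-upper 𝒮 S∈𝒮))

    stage-total : ∀ {S R} → Stage S → Stage R → R ⊑ S ⊎ S ⊑ R
    stage-total {R = R} s r with stage-compare s (stage-gap r)
    ... | inj₁ R⁺⊑S = inj₁ (⊑-trans (S⊑next R) R⁺⊑S)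
    ... | inj₂ S⊑R  = inj₂ S⊑R

    add-clique : ∀ S d → Clique S → Clique (add S d)
    add-clique S (no _) c = c
    add-clique S (yes (z , _ , z~z , z~S)) c y∈ w∈
      with ⟪⟫⁻ (Mem S ∪ ｛ z ｝) y∈ | ⟪⟫⁻ (Mem S ∪ ｛ z ｝) w∈
    ... | inj₁ y∈S  | inj₁ w∈S  = c y∈S w∈S
    ... | inj₁ y∈S  | inj₂ refl = proj₂ (z~S y∈S)
    ... | inj₂ refl | inj₁ w∈S  = proj₁ (z~S w∈S)
    ... | inj₂ refl | inj₂ refl = z~z

    stage-clique : ∀ {S} → Stage S → Clique S
    stage-clique (step s) = add-clique _ (em _) (stage-clique s)
    stage-clique (union 𝒮 f) y∈ z∈
      with S , S∈𝒮 , y∈S ← ⟪⟫⁻ (InSome 𝒮) y∈ | R , R∈𝒮 , z∈R ← ⟪⟫⁻ (InSome 𝒮) z∈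
      with stage-total (f S∈𝒮) (f R∈𝒮)
    ... | inj₁ R⊑S = stage-clique (f S∈𝒮) y∈S (R⊑S _ z∈R)
    ... | inj₂ S⊑R = stage-clique (f R∈𝒮) (S⊑R _ y∈S) z∈R

    maximum : Subset X
    maximum = ⋃ ⟪ Stage ⟫

    -- Since `Stage` has been resized to a Bool-valued family, the union of all stages is itself an
    -- instance of `union`.
    stage-maximum : Stage maximum
    stage-maximum = union ⟪ Stage ⟫ (⟪⟫⁻ Stage)

    maximum-clique : Clique maximum
    maximum-clique = stage-clique stage-maximum

    add-closed : ∀ S d → add S d ⊑ S → ¬ ∃ (Addable S)
    add-closed S (yes (z , z∉S , _)) S⁺⊑S _ = z∉S (S⁺⊑S _ (⟪⟫⁺ (Mem S ∪ ｛ z ｝) (inj₂ refl)))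
    add-closed S (no ¬∃)             _      = ¬∃

    maximum-maximal : Compatible maximum ⊆ Mem maximum
    maximum-maximal z~ = stable λ z∉ →
      add-closed maximum (em _)
        -- `next maximum` is again a stage, hence included in the union of all stages.
        (⋃-upper ⟪ Stage ⟫ (⟪⟫⁺ Stage (step stage-maximum)))
        (_ , z∉ , z~)

  -- Comparability of cardinals.

  -- A clique is a partial injection; a maximal one is total on one of the two
  -- sides.
  module _ (A B : Set a) where
    open MaximalClique {X = A × B}
      (λ (x , y) (x′ , y′) → (x ≡ x′ → y ≡ y′) × (y ≡ y′ → x ≡ x′))

    ↣-total : A ↣ B ⊎ B ↣ A
    ↣-total with em _ {∃ λ x → ∀ y → (x , y) ∉ Mem maximum}
    ... | no ¬missed = inj₁ (mk↣ λ {x} {x′} →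
            proj₂ (maximum-clique (proj₂ (image x)) (proj₂ (image x′))))
      where
      image : ∀ x → ∃ λ y → (x , y) ∈ Mem maximum
      image x = stable λ ¬∃ → ¬missed (x , λ y xy∈ → ¬∃ (y , xy∈))
    ... | yes (_ , missed) = inj₂ (mk↣ λ {y} {y′} →
            proj₁ (maximum-clique (proj₂ (preimage y)) (proj₂ (preimage y′))))
      where
      preimage : ∀ y → ∃ λ x → (x , y) ∈ Mem maximum
      -- If `y` had no preimage, its pair with the missed element would share no coordinate with any
      -- pair of the clique and so would belong to it.
      preimage y = stable λ ¬∃ → missed y (maximum-maximal
        (((λ _ → refl) , (λ _ → refl)) , λ xy∈ →
          ((λ { refl → ⊥-elim (missed _ xy∈) }) , λ { refl → ⊥-elim (¬∃ (_ , xy∈)) }) ,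
          ((λ { refl → ⊥-elim (missed _ xy∈) }) , λ { refl → ⊥-elim (¬∃ (_ , xy∈)) })))

  -- Bool-valued membership has unique proofs, so propositional equality is equality of first
  -- components, and the level does not depend on `ℓ`.
  El : {X : Set x} → Pred X ℓ → Set x
  El P = Σ _ (Mem ⟪ P ⟫)

  El-≡ : {X : Set x} {P : Pred X ℓ} {y z : El P} → proj₁ y ≡ proj₁ z → y ≡ z
  El-≡ {y = _ , t} {_ , u} refl = cong (_ ,_) (T-irrelevant t u)

  split : {X : Set x} (P : Pred X ℓ) → ∀ y → P y ⊎ ¬ P y
  split P y = toSum (em _)

  -- Doubling of infinite cardinals.

  -- The infinite type A splits into the terms of a maximal disjoint family of
  -- injective sequences and a remainder containing no further such sequence.
  -- The remainder is therefore no larger than the set W of terms, and W ⊎ W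
  -- embeds in W by splitting each sequence into even and odd terms.
  module _ {A : Set a} (s₀ : ℕ ↣ A) where
    -- For s = t the relation says that s is injective.
    open MaximalClique {X = ℕ → A} (λ s t → ∀ i j → s i ≡ t j → s ≡ t × i ≡ j)

    W : Set a
    W = Σ (ℕ → A) (Mem maximum) × ℕ

    term : W → A
    term ((s , _) , i) = s i

    term-injective : Injective _≡_ _≡_ term
    term-injective {(s , s∈) , i} {(t , t∈) , j} eq
      with refl , refl ← maximum-clique s∈ t∈ i j eq = cong (λ u → (s , u) , i) (T-irrelevant s∈ t∈)

    IsTerm : Pred A a
    IsTerm x = ∃ λ w → term w ≡ x

    Rest : Set a
    Rest = El (∁ IsTerm)

    family-inhabited : ∃ (Mem maximum)
    family-inhabited = stable λ empty → empty (to s₀ , maximum-maximal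
      ((λ i j eq → refl , injective s₀ eq) , λ t∈ → ⊥-elim (empty (_ , t∈))))

    ℕ↣W : ℕ ↣ W
    ℕ↣W = mk↣ {to = family-inhabited ,_} (cong proj₂)

    -- Such a sequence is disjoint from the family, so maximality puts it in the family, and its own
    -- values become terms.
    ¬ℕ↣Rest : ¬ (ℕ ↣ Rest)
    ¬ℕ↣Rest t = not-term 0 (((s , s∈) , 0) , refl)
      where
      s : ℕ → A
      s = proj₁ ∘ to t

      not-term : ∀ i → ¬ IsTerm (s i)
      not-term i = ⟪⟫⁻ (∁ IsTerm) (proj₂ (to t i))

      s∈ : s ∈ Mem maximum
      s∈ = maximum-maximal
        ((λ i j eq → refl , injective t (El-≡ eq)) , λ r∈ →
          (λ i j eq → ⊥-elim (not-term i (((_ , r∈) , j) , sym eq))) ,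
          (λ i j eq → ⊥-elim (not-term j (((_ , r∈) , i) , eq))))

    A↣W⊎Rest : A ↣ (W ⊎ Rest)
    A↣W⊎Rest = section-↣ [ term , proj₁ ]′ λ x →
      [ (λ (w , eq) → inj₁ w , eq)
      , (λ ¬t → inj₂ (x , ⟪⟫⁺ (∁ IsTerm) ¬t) , refl) ]′ (split IsTerm x)

    Rest↣W : Rest ↣ W
    Rest↣W = [ (λ W↣Rest → ⊥-elim (¬ℕ↣Rest (W↣Rest ↣-∘ ℕ↣W))) , id ]′ (↣-total W Rest)

    A↣W : A ↣ W
    A↣W = interleave ↣-∘ ((↣-id W ⊎-↣ Rest↣W) ↣-∘ A↣W⊎Rest)

    ⊎-absorb : (A ⊎ A) ↣ A
    ⊎-absorb = mk↣ term-injective ↣-∘ (interleave ↣-∘ (A↣W ⊎-↣ A↣W))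

  -- Injective sequences in infinite types.

  module _ {M : Set a} (inf : Infinite M) where

    -- A repetition-free vector that exhausted `M` would be a bijection from `Fin n`.
    fresh : ∀ {n} (xs : Vec M n) → Unique xs → ∃ λ y → All (y ≢_) xs
    fresh {n} xs uniq = stable λ none →
      let index : ∀ y → ∃ λ i → lookup xs i ≡ y
          index y = stable λ ¬∃ → none (y , lookup⁻ λ i eq → ¬∃ (i , sym eq))
      in inf n (⤖⇒↔ (mk⤖ {to = lookup xs}
           (lookup-injective uniq _ _ , λ y → proj₁ (index y) , λ { refl → proj₂ (index y) })))

    prefix : ∀ n → ∃ (Unique {n = n})
    prefix zero = [] , []
    prefix (suc n) = let xs , uniq = prefix n ; y , y∉ = fresh xs uniq in y ∷ xs , y∉ ∷ uniq

    seq : ℕ → M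
    seq n = proj₁ (fresh _ (proj₂ (prefix n)))

    seq-distinct : ∀ {i j} → i <′ j → seq j ≢ seq i
    seq-distinct {i} {j} i<j = All.lookup (proj₂ (fresh _ (proj₂ (prefix j)))) (seq∈prefix i<j)
      where
      seq∈prefix : ∀ {k} → i <′ k → seq i ∈ᵥ proj₁ (prefix k)
      -- By definition `seq i` is the head of `prefix (suc i)`.
      seq∈prefix ≤′-refl       = here refl
      seq∈prefix (≤′-step i<k) = there (seq∈prefix i<k)

    infinite⇒ℕ↣ : ℕ ↣ M
    infinite⇒ℕ↣ = mk↣ {to = seq} inj
      where
      inj : Injective _≡_ _≡_ seq
      inj {i} {j} eq with <-cmp i j
      ... | tri< i<j _ _ = contradiction (sym eq) (seq-distinct (≤⇒≤′ i<j))
      ... | tri≈ _ i≡j _ = i≡j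
      ... | tri> _ _ j<i = contradiction eq (seq-distinct (≤⇒≤′ j<i))

  -- `A` must be infinite: otherwise `ℕ` would embed through `M` in the finite sum `A ⊎ A`.
  infinite-⊎-absorb : {M A : Set a} → Infinite M → M ↣ (A ⊎ A) → M ↣ A
  infinite-⊎-absorb {A = A} inf f with em _ {∃ λ n → Fin n ↔ A}
  ... | no ¬fin = ⊎-absorb (infinite⇒ℕ↣ λ n e → ¬fin (n , e)) ↣-∘ f
  ... | yes (n , e) = ⊥-elim (ℕ→Fin-notInjective (to ℕ↣Fin) (injective ℕ↣Fin))
    where
    ℕ↣Fin : ℕ ↣ Fin (n + n)
    ℕ↣Fin = ↔⇒↣ (↔-sym +↔⊎) ↣-∘ (↔⇒↣ (↔-sym e ⊎-↔ ↔-sym e) ↣-∘ (f ↣-∘ infinite⇒ℕ↣ inf))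

  -- Sizes of subsets as injections between types.

  module _ {M : Set x} where

    ≽⇒↣ : {P Q : Pred M ℓ} → P ≽ Q → El Q ↣ El P
    ≽⇒↣ {P = P} {Q} f = mk↣
      {to = λ (y , t) → let z , p = to f (y , ⟪⟫⁻ Q t) in z , ⟪⟫⁺ P p}
      λ eq → El-≡ (injective f (cong proj₁ eq))

    ↣⇒≽ : {P Q : Pred M ℓ} → El Q ↣ El P → P ≽ Q
    ↣⇒≽ {P = P} {Q} f = record
      { to        = λ (y , q) → let z , t = to f (y , ⟪⟫⁺ Q q) in z , ⟪⟫⁻ P t
      ; cong      = λ eq → cong (proj₁ ∘ to f) (El-≡ eq)
      ; injective = λ eq → cong proj₁ (injective f (El-≡ eq))
      }

    El↣ : (P : Pred M ℓ) → El P ↣ M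
    El↣ P = mk↣ El-≡

    cover : (P Q : Pred M ℓ) → ∁ P ⊆ Q → M ↣ (El P ⊎ El Q)
    cover P Q ∁P⊆Q = section-↣ [ proj₁ , proj₁ ]′ λ y →
      [ (λ p → inj₁ (y , ⟪⟫⁺ P p) , refl)
      , (λ ¬p → inj₂ (y , ⟪⟫⁺ Q (∁P⊆Q ¬p)) , refl) ]′ (split P y)

    infinite⇒inhabited : Infinite M → M
    infinite⇒inhabited inf = to (infinite⇒ℕ↣ inf) 0

  ⊆⇒≽ : {M : Set x} {P Q : Pred M ℓ} → P ⊆ Q → Q ≽ P
  ⊆⇒≽ P⊆Q = record { to = λ (y , p) → y , P⊆Q p ; cong = id ; injective = id }

  ≽-trans : {M : Set x} {P Q R : Pred M ℓ} → P ≽ Q → Q ≽ R → P ≽ R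
  ≽-trans f g = Composition.injection g f

  -- Soundness of the rules.

  module Soundness
    {k g m ℓ} {P : NounSystem k} {Γ : Pred (Sentence P) g}
    (𝓜 : Model P m ℓ) (truth : ∀ ψ → ψ ∈ Γ → 𝓜 ⊨ ψ) where
    open NounSystem P
    open Model 𝓜

    ‾⁻ : ∀ {p} → ⟦ p ‾ ⟧ ⊆ ∁ ⟦ p ⟧
    ‾⁻ {p} = proj₁ (complement p)

    ‾⁺ : ∀ {p} → ∁ ⟦ p ⟧ ⊆ ⟦ p ‾ ⟧
    ‾⁺ {p} = proj₂ (complement p)

    ≽‾⇒↣ : ∀ {q} p → ⟦ q ⟧ ≽ ⟦ p ⟧ → ⟦ q ⟧ ≽ ⟦ p ‾ ⟧ → Universe ↣ El ⟦ q ⟧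
    ≽‾⇒↣ p q≽p q≽p̄ = infinite-⊎-absorb infinite
      ((≽⇒↣ q≽p ⊎-↣ ≽⇒↣ q≽p̄) ↣-∘ cover ⟦ p ⟧ ⟦ p ‾ ⟧ ‾⁺)

    universal : ∀ {q r} → Universe ↣ El ⟦ q ⟧ → ⟦ q ⟧ ≽ ⟦ r ⟧
    universal f = ↣⇒≽ (f ↣-∘ El↣ _)

    ≽-refl : ∀ {q} → ⟦ q ⟧ ≽ ⟦ q ⟧
    ≽-refl = ⊆⇒≽ id

    sound : ∀ {φ} → Γ ⊢ φ → 𝓜 ⊨ φ
    sound (leaf γ) = truth _ γ
    sound axiom y∈ = y∈
    sound (barbara d e) = sound e ∘ sound d
    sound (some-rule d) = let y , p , _ = sound d in y , p , p
    sound (conversion d) = let y , q , p = sound d in y , p , q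
    sound (darii d e) = let y , p , n = sound d in y , p , sound e n
    sound (anti d) q̄ = ‾⁺ (‾⁻ q̄ ∘ sound d)
    sound (zero-rule d) p = ⊥-elim (‾⁻ (sound d p) p)
    sound (one-rule {p = p} d) _ = stable λ ¬p → ¬p (sound d (‾⁺ ¬p))
    sound (subset-size d) = ⊆⇒≽ (sound d)
    sound (card-trans d e) = ≽-trans (sound d) (sound e)
    sound (card-∃ d e) =
      let y , p , _ = sound d ; z , q = to (sound e) (y , p) in z , q , q
    sound (more-at-least d) = proj₁ (sound d)
    sound (more-left d e) =
      let n≽p , p⋡n = sound d ; p≽q = sound e
      in ≽-trans n≽p p≽q , λ q≽n → p⋡n (≽-trans p≽q q≽n)
    sound (more-right d e) =
      let n≽p = sound d ; p≽q , q⋡p = sound e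
      in ≽-trans n≽p p≽q , λ q≽n → q⋡p (≽-trans q≽n n≽p)
    -- Without a witness `p` would be included in `q`, so `q` would be at least as large.
    sound (more-some d) = stable λ none → proj₂ (sound d)
      (⊆⇒≽ λ p → stable λ ¬q → none (_ , p , ‾⁺ ¬q))
    sound (x-rule d e) = let _ , _ , q = sound d in ⊥-elim (‾⁻ (sound e q) q)
    sound (x-card d e) = ⊥-elim (proj₂ (sound d) (sound e))
    -- Any point of the universe lies in `p` or is sent into `p` by the injection from the
    -- complement.
    sound (non-empty {p} d) with split ⟦ p ⟧ (infinite⇒inhabited infinite)
    ... | inj₁ p∋ = _ , p∋ , p∋
    ... | inj₂ p∌ = let z , p∋ = to (sound d) (_ , ‾⁺ p∌) in z , p∋ , p∋
    sound (non-empty-more {p} d) =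
      -- Here `p` is the whole universe; an injection into its empty complement fails at any point.
      ⊆⇒≽ (sound d) , λ p̄≽p → let z , z∈ = to p̄≽p (_ , full) in ‾⁻ z∈ (sound d z∈)
      where
      full : infinite⇒inhabited infinite ∈ ⟦ p ⟧
      full = stable λ ¬p → ¬p (sound d (‾⁺ ¬p))
    sound (weak-more-anti {p} d) with ↣-total (El ⟦ p ⟧) (El ⟦ p ‾ ⟧)
    ... | inj₁ p↣p̄ = universal (≽‾⇒↣ p (↣⇒≽ p↣p̄) ≽-refl)
    ... | inj₂ p̄↣p = ⊥-elim (proj₂ (sound d) (universal (≽‾⇒↣ p ≽-refl (↣⇒≽ p̄↣p))))
    sound (up {p} d e) = universal (≽‾⇒↣ p (sound d) (sound e))

proposition1p6 : (∀ a → ExcludedMiddle a) →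
    (∀ a b → Extensionality a b) →
    ∀ {k g m ℓ : Level} (P : NounSystem k) (Γ : Pred (Sentence P) g) (φ : Sentence P) →
    Γ ⊢ φ →
    Γ ⊨[ m , ℓ ] φ
proposition1p6 em ext P Γ φ d 𝓜 truth = Classical.Soundness.sound em ext 𝓜 truth d
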